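{- If a hypersequent $G$ has a derivation in $\mathbf{HR}$, then it has a CAN-free derivation in $\mathbf{HR}$.
   Context: Terms. Fix a countable set of variables $x,y,z,\dots$. Terms (in negation normal form) are generated by $A ::= x \mid \overline{x} \mid 0 \mid A+A \mid rA \mid A\sqcup A \mid A\sqcap A$, where $x$ is a variable, $\overline{x}$ is the corresponding negated variable, and $r\in\mathbb{R}_{>0}$. The negation $\overline{A}$ of a term is defined by $\overline{x}$ (for $x$), $\overline{\overline{x}}=x$, $\overline{0}=0$, $\overline{A+B}=\overline{A}+\overline{B}$, $\overline{rA}=r\overline{A}$, $\overline{A\sqcup B}=\overline{A}\sqcap\overline{B}$, $\overline{A\sqcap B}=\overline{A}\sqcup\overline{B}$. A weighted term is $r.A$ with $r\in\mathbb{R}_{>0}$; a sequent $\vdash\Gamma$ has $\Gamma$ a finite (possibly empty) multiset of weighted terms; a hypersequent is a nonempty finite multiset of sequents, written $\vdash\Gamma_1\mid\cdots\mid\vdash\Gamma_n$, and $G\mid\vdash\Gamma$ denotes the hypersequent $G$ with the sequent $\vdash\Gamma$ added. For a finite (possibly empty) sequence $\vec r=(r_1,\dots,r_n)$ of strictly positive reals, $\vec r.A$ is the multiset $r_1.A,\dots,r_n.A$, $\sum\vec r=r_1+\dots+r_n$, and $s\vec r=(sr_1,\dots,sr_n)$; for $s>0$, $s.\Gamma$ multiplies every weight in $\Gamma$ by $s$. The calculus $\mathbf{HR}$ has the rules (vectors are finite sequences of strictly positive reals): INIT: the hypersequent $\vdash$ (one empty sequent) with no premises. W: from $G$ infer $G\mid\vdash\Gamma$.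 C: from $G\mid\vdash\Gamma\mid\vdash\Gamma$ infer $G\mid\vdash\Gamma$. S: from $G\mid\vdash\Gamma_1,\Gamma_2$ infer $G\mid\vdash\Gamma_1\mid\vdash\Gamma_2$. M: from $G\mid\vdash\Gamma_1$ and $G\mid\vdash\Gamma_2$ infer $G\mid\vdash\Gamma_1,\Gamma_2$. T: for $r>0$, from $G\mid\vdash r.\Gamma$ infer $G\mid\vdash\Gamma$. ID: if $\sum\vec r=\sum\vec s$, from $G\mid\vdash\Gamma$ infer $G\mid\vdash\Gamma,\vec r.x,\vec s.\overline{x}$ ($x$ a variable). 0: from $G\mid\vdash\Gamma$ infer $G\mid\vdash\Gamma,\vec r.0$. $+$: from $G\mid\vdash\Gamma,\vec r.A,\vec r.B$ infer $G\mid\vdash\Gamma,\vec r.(A+B)$. $\times$: from $G\mid\vdash\Gamma,(s\vec r).A$ infer $G\mid\vdash\Gamma,\vec r.(sA)$. $\sqcup$: from $G\mid\vdash\Gamma,\vec r.A\mid\vdash\Gamma,\vec r.B$ infer $G\mid\vdash\Gamma,\vec r.(A\sqcup B)$. $\sqcap$: from $G\mid\vdash\Gamma,\vec r.A$ and $G\mid\vdash\Gamma,\vec r.B$ infer $G\mid\vdash\Gamma,\vec r.(A\sqcap B)$. CAN: if $\sum\vec r=\sum\vec s$, from $G\mid\vdash\Gamma,\vec s.A,\vec r.\overline{A}$ infer $G\mid\vdash\Gamma$. A derivation is a finite tree of rule instances whose leaves are INIT; it is CAN-free if it contains no instance of CAN. -}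

module Defs where

open import Level using (0ℓ)
open import Data.Bool using (Bool; true; false; T)
open import Data.Nat using (ℕ)
open import Data.List using (List; []; _∷_; _++_; map; foldr)
open import Data.Product using (Σ; ∃; _×_; _,_)
open import Data.Sum using (_⊎_)
open import Relation.Nullary using (¬_)
open import Relation.Binary.PropositionalEquality using (_≡_)
open import Relation.Binary.Structures using (IsStrictTotalOrder)
open import Algebra.Structures using (IsCommutativeRing)
open import Data.List.Relation.Binary.Permutation.Propositional using (_↭_)

-- The real numbers, given axiomatically as a (Dedekind-)complete
-- ordered field (unique up to isomorphism), with propositional equality.

record Reals : Set₁ where
  infixl 6 _+_
  infixl 7 _*_
  infix 4 _<_ _≤_
  field
    Carrier : Set
    0# 1# : Carrier
    _+_ _*_ : Carrier → Carrier → Carrier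
    -_ : Carrier → Carrier
    _<_ : Carrier → Carrier → Set
    isCommutativeRing : IsCommutativeRing _≡_ _+_ _*_ -_ 0# 1#
    0≢1 : ¬ (0# ≡ 1#)
    inverse : ∀ x → ¬ (x ≡ 0#) → Σ Carrier (λ y → x * y ≡ 1#)
    isStrictTotalOrder : IsStrictTotalOrder _≡_ _<_
    +-mono-< : ∀ {x y} z → x < y → x + z < y + z
    *-pos : ∀ {x y} → 0# < x → 0# < y → 0# < x * y

  _≤_ : Carrier → Carrier → Set
  x ≤ y = x < y ⊎ x ≡ y

  field
    complete : (P : Carrier → Set) → Σ Carrier P →
               Σ Carrier (λ b → ∀ x → P x → x ≤ b) →
               Σ Carrier (λ s → (∀ x → P x → x ≤ s) ×
                                (∀ b → (∀ x → P x → x ≤ b) → s ≤ b))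

module HR (ℝ : Reals) where
  open Reals ℝ

  -- strictly positive reals (positivity proof irrelevant, so equality
  -- of positive reals is equality of their values)
  record ℝ⁺ : Set where
    constructor mk⁺
    field
      val : Carrier
      .pos : 0# < val
  open ℝ⁺ public

  _*⁺_ : ℝ⁺ → ℝ⁺ → ℝ⁺
  mk⁺ a p *⁺ mk⁺ b q = mk⁺ (a * b) (*-pos p q)

  -- terms in negation normal form; variables are natural numbers
  data Term : Set where
    var   : ℕ → Term
    covar : ℕ → Term
    zero  : Term
    _⊕_   : Term → Term → Term
    _·_   : ℝ⁺ → Term → Term
    _⊔_   : Term → Term → Term
    _⊓_   : Term → Term → Term

  neg : Term → Term
  neg (var x) = covar x
  neg (covar x) = var x
  neg zero = zero
  neg (A ⊕ B) = neg A ⊕ neg B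
  neg (r · A) = r · neg A
  neg (A ⊔ B) = neg A ⊓ neg B
  neg (A ⊓ B) = neg A ⊔ neg B

  -- weighted terms, sequents (multisets as lists up to permutation),
  -- hypersequents (multisets of sequents as lists up to permutation)
  WTerm : Set
  WTerm = ℝ⁺ × Term

  Sequent : Set
  Sequent = List WTerm

  Hypersequent : Set
  Hypersequent = List Sequent

  Vect : Set
  Vect = List ℝ⁺

  Σv : Vect → Carrier
  Σv = foldr (λ r acc → val r + acc) 0#

  _∙_ : Vect → Term → Sequent
  rs ∙ A = map (λ r → (r , A)) rs

  scaleV : ℝ⁺ → Vect → Vect
  scaleV s = map (s *⁺_)

  scaleS : ℝ⁺ → Sequent → Sequent
  scaleS s = map (λ { (r , A) → (s *⁺ r , A) })

  -- Derivations in HR.  The context hypersequent G may be empty;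
  -- "G | ⊢ Γ" is written  Γ ∷ G.  The rules ex-H / ex-S only express
  -- that hypersequents and sequents are multisets.  The flag 'withCAN'
  -- says whether the CAN rule may be used: Der true = HR,
  -- Der false = CAN-free HR.
  data Der (withCAN : Bool) : Hypersequent → Set where
    ex-H  : ∀ {G G'} → G ↭ G' → Der withCAN G → Der withCAN G'
    ex-S  : ∀ {G Γ Γ'} → Γ ↭ Γ' → Der withCAN (Γ ∷ G) → Der withCAN (Γ' ∷ G)
    INIT  : Der withCAN ([] ∷ [])
    W     : ∀ {G Γ} → Der withCAN G → Der withCAN (Γ ∷ G)
    C     : ∀ {G Γ} → Der withCAN (Γ ∷ Γ ∷ G) → Der withCAN (Γ ∷ G)
    S     : ∀ {G Γ₁ Γ₂} → Der withCAN ((Γ₁ ++ Γ₂) ∷ G) → Der withCAN (Γ₁ ∷ Γ₂ ∷ G)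
    M     : ∀ {G Γ₁ Γ₂} → Der withCAN (Γ₁ ∷ G) → Der withCAN (Γ₂ ∷ G) →
            Der withCAN ((Γ₁ ++ Γ₂) ∷ G)
    Tr    : ∀ {G Γ} (r : ℝ⁺) → Der withCAN (scaleS r Γ ∷ G) → Der withCAN (Γ ∷ G)
    ID    : ∀ {G Γ} (rs ss : Vect) (x : ℕ) → Σv rs ≡ Σv ss →
            Der withCAN (Γ ∷ G) →
            Der withCAN ((Γ ++ rs ∙ var x ++ ss ∙ covar x) ∷ G)
    Z     : ∀ {G Γ} (rs : Vect) → Der withCAN (Γ ∷ G) →
            Der withCAN ((Γ ++ rs ∙ zero) ∷ G)
    plus  : ∀ {G Γ} (rs : Vect) (A B : Term) →
            Der withCAN ((Γ ++ rs ∙ A ++ rs ∙ B) ∷ G) →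
            Der withCAN ((Γ ++ rs ∙ (A ⊕ B)) ∷ G)
    times : ∀ {G Γ} (rs : Vect) (s : ℝ⁺) (A : Term) →
            Der withCAN ((Γ ++ scaleV s rs ∙ A) ∷ G) →
            Der withCAN ((Γ ++ rs ∙ (s · A)) ∷ G)
    join  : ∀ {G Γ} (rs : Vect) (A B : Term) →
            Der withCAN ((Γ ++ rs ∙ A) ∷ (Γ ++ rs ∙ B) ∷ G) →
            Der withCAN ((Γ ++ rs ∙ (A ⊔ B)) ∷ G)
    meet  : ∀ {G Γ} (rs : Vect) (A B : Term) →
            Der withCAN ((Γ ++ rs ∙ A) ∷ G) →
            Der withCAN ((Γ ++ rs ∙ B) ∷ G) →
            Der withCAN ((Γ ++ rs ∙ (A ⊓ B)) ∷ G)
    CAN   : ∀ {G Γ} → T withCAN → (rs ss : Vect) (A : Term) → Σv rs ≡ Σv ss →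
            Der withCAN ((Γ ++ ss ∙ A ++ rs ∙ neg A) ∷ G) →
            Der withCAN (Γ ∷ G)

  HRDerivable : Hypersequent → Set
  HRDerivable = Der true

  CANfreeDerivable : Hypersequent → Set
  CANfreeDerivable = Der false

{-# OPTIONS --safe #-}
module Submission where

-- Read a sequent as the sum of its weighted terms under a real valuation of the variables.
-- Every rule, CAN included, preserves the property that no valuation makes all sequents
-- negative. Conversely such a hypersequent has a CAN-free derivation: the logical rules
-- are semantically invertible, which reduces to sequents of literals, and there
-- Fourier-Motzkin elimination either finds a refuting valuation or can be replayed in the
-- calculus. Eliminating x replaces Γ, Δ with x-coefficients c > 0 > d by |d|.Γ, c.Δ (rules S,
-- T and C recover Γ and Δ), and ID removes x from sequents where its coefficient is 0.

open import Algebra.Bundles using (CommutativeRing)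
open import Data.Empty using (⊥-elim)
open import Data.List using (List; []; _∷_; _++_; map; filter; cartesianProductWith)
open import Data.List.Membership.Propositional using (_∈_)
open import Data.List.Membership.Propositional.Properties
  using (∈-filter⁺; ∈-filter⁻; ∈-++⁺ˡ; ∈-++⁺ʳ; ∈-∃++;
         ∈-cartesianProductWith⁺; ∈-cartesianProductWith⁻)
open import Data.List.Properties using (++-assoc; ++-identityʳ)
open import Data.List.Relation.Binary.Permutation.Propositional
  using (_↭_; refl; prep; swap; trans; ↭-sym; ↭-reflexive)
open import Data.List.Relation.Binary.Permutation.Propositional.Properties
  using (All-resp-↭; shift; ++-comm; ++⁺ˡ)
open import Data.List.Relation.Unary.All as All using (All; []; _∷_)
import Data.List.Relation.Unary.All.Properties as Allₚ
open import Data.List.Relation.Binary.Subset.Propositional using (_⊆_)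
open import Data.List.Relation.Unary.Any using (there)
open import Data.Nat as ℕ using (ℕ; zero; suc)
import Data.Nat.Properties as ℕₚ
open import Data.Product using (Σ; ∃; _×_; _,_; proj₁; proj₂)
open import Data.Sum using (_⊎_; inj₁; inj₂)
open import Function using (_∘_)
open import Relation.Binary.Bundles using (StrictPartialOrder; TotalOrder)
open import Relation.Binary.Definitions using (tri<; tri≈; tri>)
open import Relation.Binary.PropositionalEquality as ≡
  using (_≡_; _≢_; cong; cong₂; subst; subst₂)
open import Relation.Binary.Structures using (module IsStrictTotalOrder)
import Relation.Binary.Construct.StrictToNonStrict as StrictToNonStrict
open import Relation.Nullary using (¬_; yes; no; recompute)

open import Defs

-- Ordered field arithmetic and separation of finite sets.

module OrderedField (ℝ : Reals) where
  open Reals ℝ public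

  commutativeRing : CommutativeRing _ _
  commutativeRing = record { isCommutativeRing = isCommutativeRing }

  open CommutativeRing commutativeRing public
    using (+-comm; +-assoc; *-comm; *-assoc; +-identityˡ; +-identityʳ; distribˡ; distribʳ;
           -‿inverseˡ; -‿inverseʳ; *-identityˡ; *-identityʳ; zeroˡ; zeroʳ;
           ring; +-group; commutativeSemiring)
  open import Algebra.Properties.Ring ring public
    using (-‿involutive; -‿distribˡ-*; -‿distribʳ-*; -0#≈0#; -‿+-comm)
  open import Algebra.Properties.Group +-group public using (x∙y⁻¹≈ε⇒x≈y)
  open import Algebra.Solver.Ring.NaturalCoefficients.Default commutativeSemiring public
    using (solve; _:+_; _:*_; _:=_)
  open IsStrictTotalOrder isStrictTotalOrder public
    using (compare; _<?_; _≟_) renaming (trans to <-trans; irrefl to <-irrefl)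

  totalOrder : TotalOrder _ _ _
  totalOrder = record { isTotalOrder = StrictToNonStrict.isTotalOrder _≡_ _<_ isStrictTotalOrder }

  open import Algebra.Construct.NaturalChoice.Min totalOrder public
    using () renaming (_⊓_ to min; minOperator to minOp)
  open import Algebra.Construct.NaturalChoice.Max totalOrder public
    using () renaming (_⊔_ to max; maxOperator to maxOp)
  open import Algebra.Construct.NaturalChoice.MinMaxOp minOp maxOp public
    using () renaming (x⊓y≤x to min≤x; x⊓y≤y to min≤y; ⊓-sel to min-sel; ⊔-sel to max-sel;
                       x≤x⊔y to x≤max; x≤y⊔x to y≤max;
                       antimono-≤-distrib-⊓ to antimono-min; antimono-≤-distrib-⊔ to antimono-max)

  strictPartialOrder : StrictPartialOrder _ _ _
  strictPartialOrder = record
    { isStrictPartialOrder = IsStrictTotalOrder.isStrictPartialOrder isStrictTotalOrder }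

  module <-Reasoning where
    open import Relation.Binary.Reasoning.StrictPartialOrder strictPartialOrder public

  ≮⇒≥ : ∀ {x y} → ¬ (x < y) → y ≤ x
  ≮⇒≥ {x} {y} x≮y with compare x y
  ... | tri< x<y _ _ = ⊥-elim (x≮y x<y)
  ... | tri≈ _ x≡y _ = inj₂ (≡.sym x≡y)
  ... | tri> _ _ y<x = inj₁ y<x

  ≤⇒≯ : ∀ {x y} → x ≤ y → ¬ (y < x)
  ≤⇒≯ (inj₁ x<y) y<x = <-irrefl ≡.refl (<-trans x<y y<x)
  ≤⇒≯ (inj₂ x≡y) y<x = <-irrefl (≡.sym x≡y) y<x

  ≤-<-trans : ∀ {x y z} → x ≤ y → y < z → x < z
  ≤-<-trans (inj₁ x<y) y<z = <-trans x<y y<z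
  ≤-<-trans (inj₂ ≡.refl) y<z = y<z

  <-≤-trans : ∀ {x y z} → x < y → y ≤ z → x < z
  <-≤-trans x<y (inj₁ y<z) = <-trans x<y y<z
  <-≤-trans x<y (inj₂ ≡.refl) = x<y

  +-monoʳ-< : ∀ z {x y} → x < y → z + x < z + y
  +-monoʳ-< z {x} {y} x<y = subst₂ _<_ (+-comm x z) (+-comm y z) (+-mono-< z x<y)

  +-monoʳ-≤ : ∀ z {x y} → x ≤ y → z + x ≤ z + y
  +-monoʳ-≤ z (inj₁ x<y) = inj₁ (+-monoʳ-< z x<y)
  +-monoʳ-≤ z (inj₂ x≡y) = inj₂ (cong (z +_) x≡y)

  x+y-y≡x : ∀ x y → (x + y) + - y ≡ x
  x+y-y≡x x y = ≡.trans (+-assoc x y (- y)) (≡.trans (cong (x +_) (-‿inverseʳ y)) (+-identityʳ x))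

  x-y+y≡x : ∀ x y → (x + - y) + y ≡ x
  x-y+y≡x x y = ≡.trans (+-assoc x (- y) y) (≡.trans (cong (x +_) (-‿inverseˡ y)) (+-identityʳ x))

  +-cancelʳ-< : ∀ {x y} z → x + z < y + z → x < y
  +-cancelʳ-< {x} {y} z p = subst₂ _<_ (x+y-y≡x x z) (x+y-y≡x y z) (+-mono-< (- z) p)

  +-neg : ∀ {x y} → x < 0# → y < 0# → x + y < 0#
  +-neg {x} {y} x<0 y<0 = <-trans (subst (x + y <_) (+-identityʳ x) (+-monoʳ-< x y<0)) x<0

  +-nonneg : ∀ {x y} → 0# ≤ x → 0# ≤ y → 0# ≤ x + y
  +-nonneg {x} {y} (inj₁ 0<x) 0≤y =
    inj₁ (<-≤-trans 0<x (subst (_≤ x + y) (+-identityʳ x) (+-monoʳ-≤ x 0≤y)))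
  +-nonneg {y = y} (inj₂ ≡.refl) 0≤y = subst (0# ≤_) (≡.sym (+-identityˡ y)) 0≤y

  sum<0⇒ : ∀ x y → x + y < 0# → x < 0# ⊎ y < 0#
  sum<0⇒ x y x+y<0 with x <? 0# | y <? 0#
  ... | yes x<0 | _       = inj₁ x<0
  ... | no _    | yes y<0 = inj₂ y<0
  ... | no x≮0  | no y≮0  = ⊥-elim (≤⇒≯ (+-nonneg (≮⇒≥ x≮0) (≮⇒≥ y≮0)) x+y<0)

  x<0⇒0<-x : ∀ {x} → x < 0# → 0# < - x
  x<0⇒0<-x {x} x<0 = subst₂ _<_ (-‿inverseʳ x) (+-identityˡ (- x)) (+-mono-< (- x) x<0)

  *-monoˡ-< : ∀ {r x y} → 0# < r → x < y → r * x < r * y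
  *-monoˡ-< {r} {x} {y} 0<r x<y = begin-strict
    r * x                        ≡⟨ +-identityˡ (r * x) ⟨
    0# + r * x                   <⟨ +-mono-< (r * x) (*-pos 0<r 0<y-x) ⟩
    r * (y + - x) + r * x        ≡⟨ distribˡ r (y + - x) x ⟨
    r * ((y + - x) + x)          ≡⟨ cong (r *_) (x-y+y≡x y x) ⟩
    r * y                        ∎
    where
    open <-Reasoning
    0<y-x : 0# < y + - x
    0<y-x = subst (_< y + - x) (-‿inverseʳ x) (+-mono-< (- x) x<y)

  *-monoˡ-≤ : ∀ {r x y} → 0# ≤ r → x ≤ y → r * x ≤ r * y
  *-monoˡ-≤ {r} _ (inj₂ x≡y) = inj₂ (cong (r *_) x≡y)
  *-monoˡ-≤ (inj₁ 0<r) (inj₁ x<y) = inj₁ (*-monoˡ-< 0<r x<y)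
  *-monoˡ-≤ {x = x} {y} (inj₂ ≡.refl) (inj₁ x<y) = inj₂ (≡.trans (zeroˡ x) (≡.sym (zeroˡ y)))

  *-cancelˡ-< : ∀ {r x y} → 0# < r → r * x < r * y → x < y
  *-cancelˡ-< {r} {x} {y} 0<r rx<ry with x <? y
  ... | yes x<y = x<y
  ... | no x≮y  = ⊥-elim (≤⇒≯ (*-monoˡ-≤ (inj₁ 0<r) (≮⇒≥ x≮y)) rx<ry)

  *-pos-neg : ∀ {r x} → 0# < r → x < 0# → r * x < 0#
  *-pos-neg {r} {x} 0<r x<0 = subst (r * x <_) (zeroʳ r) (*-monoˡ-< 0<r x<0)

  -- Adding `x + y` to both sides turns the claim into the hypothesis.
  neg-antimono-< : ∀ {x y} → x < y → - y < - x
  neg-antimono-< {x} {y} x<y = +-cancelʳ-< (x + y) (subst₂ _<_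
    (≡.sym (≡.trans (cong (- y +_) (+-comm x y)) (≡.trans (≡.sym (+-assoc (- y) y x))
      (≡.trans (cong (_+ x) (-‿inverseˡ y)) (+-identityˡ x)))))
    (≡.sym (≡.trans (≡.sym (+-assoc (- x) x y)) (≡.trans (cong (_+ y) (-‿inverseˡ x)) (+-identityˡ y))))
    x<y)

  neg-antimono-≤ : ∀ {x y} → x ≤ y → - y ≤ - x
  neg-antimono-≤ (inj₁ x<y) = inj₁ (neg-antimono-< x<y)
  neg-antimono-≤ (inj₂ x≡y) = inj₂ (cong -_ (≡.sym x≡y))

  *-antimonoˡ-< : ∀ {r x y} → r < 0# → x < y → r * y < r * x
  *-antimonoˡ-< {r} {x} {y} r<0 x<y = subst₂ _<_ (eq y) (eq x)
    (neg-antimono-< (*-monoˡ-< (x<0⇒0<-x r<0) x<y))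
    where
    eq : ∀ z → - (- r * z) ≡ r * z
    eq z = ≡.trans (cong -_ (≡.sym (-‿distribˡ-* r z))) (-‿involutive (r * z))

  -max≡min : ∀ x y → - max x y ≡ min (- x) (- y)
  -max≡min = antimono-max (cong -_) neg-antimono-≤

  -min≡max : ∀ x y → - min x y ≡ max (- x) (- y)
  -min≡max = antimono-min (cong -_) neg-antimono-≤

  0<1 : 0# < 1#
  0<1 with compare 0# 1#
  ... | tri< 0<1 _ _ = 0<1
  ... | tri≈ _ 0≡1 _ = ⊥-elim (0≢1 0≡1)
  ... | tri> _ _ 1<0 = ⊥-elim (<-irrefl ≡.refl (<-trans 0<-1*-1 1<0))
    where
    0<-1*-1 : 0# < 1#
    -- Under `1# < 0#` the element `- 1#` is positive, so its square is positive, and that square is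
    -- `1#`.
    0<-1*-1 = subst (0# <_)
      (≡.trans (≡.sym (-‿distribˡ-* 1# (- 1#)))
        (≡.trans (cong -_ (*-identityˡ (- 1#))) (-‿involutive 1#)))
      (*-pos (x<0⇒0<-x 1<0) (x<0⇒0<-x 1<0))

  x<x+1 : ∀ x → x < x + 1#
  x<x+1 x = subst (_< x + 1#) (+-identityʳ x) (+-monoʳ-< x 0<1)

  x-1<x : ∀ x → x + - 1# < x
  x-1<x x = subst (x + - 1# <_) (x-y+y≡x x 1#) (x<x+1 (x + - 1#))

  -- The witness is the midpoint. Both inequalities are checked after multiplying by `2#`, which is
  -- invertible because it is positive.
  <-dense : ∀ {x y} → x < y → ∃ λ z → x < z × z < y
  <-dense {x} {y} x<y = half * (x + y) ,
      *-cancelˡ-< 0<2 (subst₂ _<_ (≡.sym (two x)) (≡.sym (mid (x + y))) (+-monoʳ-< x x<y)) ,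
      *-cancelˡ-< 0<2 (subst₂ _<_ (≡.sym (mid (x + y))) (≡.sym (two y)) (+-mono-< y x<y))
    where
    2# : Carrier
    2# = 1# + 1#
    0<2 : 0# < 2#
    0<2 = <-trans 0<1 (x<x+1 1#)
    inv : Σ Carrier (λ h → 2# * h ≡ 1#)
    inv = inverse 2# (λ 2≡0 → <-irrefl (≡.sym 2≡0) 0<2)
    half : Carrier
    half = proj₁ inv
    two : ∀ z → 2# * z ≡ z + z
    two z = ≡.trans (distribʳ z 1# 1#) (cong₂ _+_ (*-identityˡ z) (*-identityˡ z))
    mid : ∀ z → 2# * (half * z) ≡ z
    mid z = ≡.trans (≡.sym (*-assoc 2# half z)) (≡.trans (cong (_* z) (proj₂ inv)) (*-identityˡ z))

  below-all : ∀ us → ∃ λ t → All (t <_) us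
  below-all [] = 0# , []
  below-all (u ∷ us) with below-all us
  ... | t , t<us with t <? u
  ...   | yes t<u = t , t<u ∷ t<us
  ...   | no t≮u  = u + - 1# , x-1<x u ∷ All.map (<-trans (<-≤-trans (x-1<x u) (≮⇒≥ t≮u))) t<us

  above-one-below-all : ∀ l us → All (l <_) us → ∃ λ t → l < t × All (t <_) us
  above-one-below-all l [] [] = l + 1# , x<x+1 l , []
  above-one-below-all l (u ∷ us) (l<u ∷ l<us) with above-one-below-all l us l<us
  ... | t , l<t , t<us with t <? u
  ...   | yes t<u = t , l<t , t<u ∷ t<us
  ...   | no t≮u  with <-dense l<u
  ...     | s , l<s , s<u = s , l<s , s<u ∷ All.map (<-trans (<-≤-trans s<u (≮⇒≥ t≮u))) t<us

  -- The order is dense and has no endpoints, so there is room even when one or both lists are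
  -- empty. The point found becomes the shift of the eliminated variable.
  interpolate : ∀ ls us → All (λ l → All (l <_) us) ls → ∃ λ t → All (_< t) ls × All (t <_) us
  interpolate [] us [] with below-all us
  ... | t , t<us = t , [] , t<us
  interpolate (l ∷ ls) us (l<us ∷ ls<us) with interpolate ls us ls<us
  ... | t , ls<t , t<us with l <? t
  ...   | yes l<t = t , l<t ∷ ls<t , t<us
  -- Here `t ≤ l`, so every point above `l` also exceeds the remaining lower bounds, and only `l`
  -- and the upper bounds still matter.
  ...   | no l≮t with above-one-below-all l us l<us
  ...     | s , l<s , s<us =
            s , l<s ∷ All.map (λ x<t → <-trans (<-≤-trans x<t (≮⇒≥ l≮t)) l<s) ls<t , s<us

-- Real-valued semantics of terms and sequents.

module Semantics (ℝ : Reals) where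
  open OrderedField ℝ
  open HR ℝ

  Valuation : Set
  Valuation = ℕ → Carrier

  ⟦_⟧ : Term → Valuation → Carrier
  ⟦ var x ⟧ v = v x
  ⟦ covar x ⟧ v = - v x
  ⟦ zero ⟧ v = 0#
  ⟦ A ⊕ B ⟧ v = ⟦ A ⟧ v + ⟦ B ⟧ v
  ⟦ r · A ⟧ v = val r * ⟦ A ⟧ v
  ⟦ A ⊔ B ⟧ v = max (⟦ A ⟧ v) (⟦ B ⟧ v)
  ⟦ A ⊓ B ⟧ v = min (⟦ A ⟧ v) (⟦ B ⟧ v)

  eval : Valuation → Sequent → Carrier
  eval v [] = 0#
  eval v ((r , A) ∷ Γ) = val r * ⟦ A ⟧ v + eval v Γ

  Refutes : Valuation → Hypersequent → Set
  Refutes v = All (λ Γ → eval v Γ < 0#)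

  -- For a nonempty hypersequent this says that the maximum of the sums is nowhere negative. The
  -- empty one is refuted by every valuation, hence not valid.
  Valid : Hypersequent → Set
  Valid G = ∀ v → ¬ Refutes v G

  -- Negating reals reverses the order and so exchanges `max` and `min`, just as `neg` exchanges
  -- joins and meets.
  ⟦neg⟧ : ∀ A v → ⟦ neg A ⟧ v ≡ - ⟦ A ⟧ v
  ⟦neg⟧ (var x) v = ≡.refl
  ⟦neg⟧ (covar x) v = ≡.sym (-‿involutive (v x))
  ⟦neg⟧ zero v = ≡.sym -0#≈0#
  ⟦neg⟧ (A ⊕ B) v = ≡.trans (cong₂ _+_ (⟦neg⟧ A v) (⟦neg⟧ B v)) (-‿+-comm (⟦ A ⟧ v) (⟦ B ⟧ v))
  ⟦neg⟧ (r · A) v = ≡.trans (cong (val r *_) (⟦neg⟧ A v)) (≡.sym (-‿distribʳ-* (val r) (⟦ A ⟧ v)))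
  ⟦neg⟧ (A ⊔ B) v = ≡.trans (cong₂ min (⟦neg⟧ A v) (⟦neg⟧ B v)) (≡.sym (-max≡min (⟦ A ⟧ v) (⟦ B ⟧ v)))
  ⟦neg⟧ (A ⊓ B) v = ≡.trans (cong₂ max (⟦neg⟧ A v) (⟦neg⟧ B v)) (≡.sym (-min≡max (⟦ A ⟧ v) (⟦ B ⟧ v)))

  eval-++ : ∀ v Γ Δ → eval v (Γ ++ Δ) ≡ eval v Γ + eval v Δ
  eval-++ v [] Δ = ≡.sym (+-identityˡ (eval v Δ))
  eval-++ v ((r , A) ∷ Γ) Δ =
    ≡.trans (cong (val r * ⟦ A ⟧ v +_) (eval-++ v Γ Δ)) (≡.sym (+-assoc _ (eval v Γ) (eval v Δ)))

  eval-↭ : ∀ v {Γ Δ} → Γ ↭ Δ → eval v Γ ≡ eval v Δ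
  eval-↭ v refl = ≡.refl
  eval-↭ v (prep (r , A) p) = cong (val r * ⟦ A ⟧ v +_) (eval-↭ v p)
  eval-↭ v (swap (r , A) (s , B) p) = ≡.trans
    (cong (λ e → val r * ⟦ A ⟧ v + (val s * ⟦ B ⟧ v + e)) (eval-↭ v p))
    (solve 3 (λ a b e → a :+ (b :+ e) := b :+ (a :+ e)) ≡.refl _ _ _)
  eval-↭ v (trans p q) = ≡.trans (eval-↭ v p) (eval-↭ v q)

  eval-∙ : ∀ v rs A → eval v (rs ∙ A) ≡ Σv rs * ⟦ A ⟧ v
  eval-∙ v [] A = ≡.sym (zeroˡ (⟦ A ⟧ v))
  eval-∙ v (r ∷ rs) A =
    ≡.trans (cong (val r * ⟦ A ⟧ v +_) (eval-∙ v rs A)) (≡.sym (distribʳ (⟦ A ⟧ v) (val r) (Σv rs)))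

  eval-++-∙ : ∀ v Γ rs A → eval v (Γ ++ rs ∙ A) ≡ eval v Γ + Σv rs * ⟦ A ⟧ v
  eval-++-∙ v Γ rs A = ≡.trans (eval-++ v Γ (rs ∙ A)) (cong (eval v Γ +_) (eval-∙ v rs A))

  eval-scaleS : ∀ v s Γ → eval v (scaleS s Γ) ≡ val s * eval v Γ
  eval-scaleS v s [] = ≡.sym (zeroʳ (val s))
  eval-scaleS v s ((r , A) ∷ Γ) = ≡.trans (cong (_ +_) (eval-scaleS v s Γ))
    (solve 4 (λ s r a e → s :* r :* a :+ s :* e := s :* (r :* a :+ e)) ≡.refl
      (val s) (val r) (⟦ A ⟧ v) (eval v Γ))

  -- The stored positivity proof is irrelevant; decidability of `<` allows it to be recomputed.
  0<val : ∀ r → 0# < val r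
  0<val (mk⁺ r 0<r) = recompute (0# <? r) 0<r

  Σv-nonneg : ∀ rs → 0# ≤ Σv rs
  Σv-nonneg [] = inj₂ ≡.refl
  Σv-nonneg (r ∷ rs) = +-nonneg (inj₁ (0<val r)) (Σv-nonneg rs)

  Σv-scaleV : ∀ s rs → Σv (scaleV s rs) ≡ val s * Σv rs
  Σv-scaleV s [] = ≡.sym (zeroʳ (val s))
  Σv-scaleV s (r ∷ rs) =
    ≡.trans (cong (val s * val r +_) (Σv-scaleV s rs)) (≡.sym (distribˡ (val s) (val r) (Σv rs)))

  eval-ID : ∀ v Γ rs ss x → Σv rs ≡ Σv ss →
            eval v (Γ ++ rs ∙ var x ++ ss ∙ covar x) ≡ eval v Γ
  eval-ID v Γ rs ss x rs≡ss = begin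
    eval v (Γ ++ rs ∙ var x ++ ss ∙ covar x)            ≡⟨ eval-++ v Γ _ ⟩
    eval v Γ + eval v (rs ∙ var x ++ ss ∙ covar x)      ≡⟨ cong (eval v Γ +_) (eval-++-∙ v (rs ∙ var x) ss (covar x)) ⟩
    eval v Γ + (eval v (rs ∙ var x) + Σv ss * - v x)    ≡⟨ cong (λ e → eval v Γ + (e + Σv ss * - v x)) (eval-∙ v rs (var x)) ⟩
    eval v Γ + (Σv rs * v x + Σv ss * - v x)            ≡⟨ cong (λ e → eval v Γ + (e * v x + Σv ss * - v x)) rs≡ss ⟩
    eval v Γ + (Σv ss * v x + Σv ss * - v x)            ≡⟨ cong (eval v Γ +_) (distribˡ (Σv ss) (v x) (- v x)) ⟨
    eval v Γ + Σv ss * (v x + - v x)                    ≡⟨ cong (λ e → eval v Γ + Σv ss * e) (-‿inverseʳ (v x)) ⟩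
    eval v Γ + Σv ss * 0#                               ≡⟨ cong (eval v Γ +_) (zeroʳ (Σv ss)) ⟩
    eval v Γ + 0#                                       ≡⟨ +-identityʳ (eval v Γ) ⟩
    eval v Γ                                            ∎
    where open ≡.≡-Reasoning

  -- By `⟦neg⟧` the cancelled terms contribute `Σv ss * a` and `Σv rs * - a`, which add up to zero
  -- when the weights have equal sums. Soundness of CAN rests on this alone.
  eval-CAN : ∀ v Γ rs ss A → Σv rs ≡ Σv ss →
             eval v (Γ ++ ss ∙ A ++ rs ∙ neg A) ≡ eval v Γ
  eval-CAN v Γ rs ss A rs≡ss = begin
    eval v (Γ ++ ss ∙ A ++ rs ∙ neg A)                  ≡⟨ eval-++ v Γ _ ⟩
    eval v Γ + eval v (ss ∙ A ++ rs ∙ neg A)            ≡⟨ cong (eval v Γ +_) (eval-++-∙ v (ss ∙ A) rs (neg A)) ⟩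
    eval v Γ + (eval v (ss ∙ A) + Σv rs * ⟦ neg A ⟧ v)  ≡⟨ cong₂ (λ e f → eval v Γ + (e + f)) (eval-∙ v ss A) (cong₂ _*_ rs≡ss (⟦neg⟧ A v)) ⟩
    eval v Γ + (Σv ss * a + Σv ss * - a)                ≡⟨ cong (eval v Γ +_) (distribˡ (Σv ss) a (- a)) ⟨
    eval v Γ + Σv ss * (a + - a)                        ≡⟨ cong (λ e → eval v Γ + Σv ss * e) (-‿inverseʳ a) ⟩
    eval v Γ + Σv ss * 0#                               ≡⟨ cong (eval v Γ +_) (zeroʳ (Σv ss)) ⟩
    eval v Γ + 0#                                       ≡⟨ +-identityʳ (eval v Γ) ⟩
    eval v Γ                                            ∎
    where
    open ≡.≡-Reasoning
    a : Carrier
    a = ⟦ A ⟧ v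

  eval-Z : ∀ v Γ rs → eval v (Γ ++ rs ∙ zero) ≡ eval v Γ
  eval-Z v Γ rs = ≡.trans (eval-++-∙ v Γ rs zero)
    (≡.trans (cong (eval v Γ +_) (zeroʳ (Σv rs))) (+-identityʳ (eval v Γ)))

  eval-plus : ∀ v Γ rs A B → eval v (Γ ++ rs ∙ A ++ rs ∙ B) ≡ eval v (Γ ++ rs ∙ (A ⊕ B))
  eval-plus v Γ rs A B = begin
    eval v (Γ ++ rs ∙ A ++ rs ∙ B)                      ≡⟨ eval-++ v Γ _ ⟩
    eval v Γ + eval v (rs ∙ A ++ rs ∙ B)                ≡⟨ cong (eval v Γ +_) (eval-++-∙ v (rs ∙ A) rs B) ⟩
    eval v Γ + (eval v (rs ∙ A) + Σv rs * ⟦ B ⟧ v)      ≡⟨ cong (λ e → eval v Γ + (e + Σv rs * ⟦ B ⟧ v)) (eval-∙ v rs A) ⟩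
    eval v Γ + (Σv rs * ⟦ A ⟧ v + Σv rs * ⟦ B ⟧ v)      ≡⟨ cong (eval v Γ +_) (distribˡ (Σv rs) (⟦ A ⟧ v) (⟦ B ⟧ v)) ⟨
    eval v Γ + Σv rs * (⟦ A ⟧ v + ⟦ B ⟧ v)              ≡⟨ eval-++-∙ v Γ rs (A ⊕ B) ⟨
    eval v (Γ ++ rs ∙ (A ⊕ B))                          ∎
    where open ≡.≡-Reasoning

  eval-times : ∀ v Γ rs s A → eval v (Γ ++ scaleV s rs ∙ A) ≡ eval v (Γ ++ rs ∙ (s · A))
  eval-times v Γ rs s A = begin
    eval v (Γ ++ scaleV s rs ∙ A)                       ≡⟨ eval-++-∙ v Γ (scaleV s rs) A ⟩
    eval v Γ + Σv (scaleV s rs) * ⟦ A ⟧ v               ≡⟨ cong (λ e → eval v Γ + e * ⟦ A ⟧ v) (Σv-scaleV s rs) ⟩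
    eval v Γ + val s * Σv rs * ⟦ A ⟧ v                  ≡⟨ solve 4 (λ g s t a → g :+ s :* t :* a := g :+ t :* (s :* a)) ≡.refl
                                                             (eval v Γ) (val s) (Σv rs) (⟦ A ⟧ v) ⟩
    eval v Γ + Σv rs * (val s * ⟦ A ⟧ v)                ≡⟨ eval-++-∙ v Γ rs (s · A) ⟨
    eval v (Γ ++ rs ∙ (s · A))                          ∎
    where open ≡.≡-Reasoning

  eval-cong : ∀ v Γ rs A B → ⟦ A ⟧ v ≡ ⟦ B ⟧ v → eval v (Γ ++ rs ∙ A) ≡ eval v (Γ ++ rs ∙ B)
  eval-cong v Γ rs A B A≡B = ≡.trans (eval-++-∙ v Γ rs A)
    (≡.trans (cong (λ a → eval v Γ + Σv rs * a) A≡B) (≡.sym (eval-++-∙ v Γ rs B)))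

  eval-mono : ∀ v Γ rs A B → ⟦ A ⟧ v ≤ ⟦ B ⟧ v → eval v (Γ ++ rs ∙ A) ≤ eval v (Γ ++ rs ∙ B)
  eval-mono v Γ rs A B A≤B = subst₂ _≤_
    (≡.sym (eval-++-∙ v Γ rs A)) (≡.sym (eval-++-∙ v Γ rs B))
    (+-monoʳ-≤ (eval v Γ) (*-monoˡ-≤ (Σv-nonneg rs) A≤B))

  -- Soundness and invertibility of the rules.

  Valid-↭ : ∀ {G H} → G ↭ H → Valid G → Valid H
  Valid-↭ p valid v = valid v ∘ All-resp-↭ (↭-sym p)

  -- Equations of values can be read in both directions, so one equation yields both the soundness
  -- and the invertibility of a rule such as `plus`, `times` or `Z`.
  Valid-head : ∀ {Γ Δ G} → (∀ v → eval v Γ ≡ eval v Δ) → Valid (Γ ∷ G) → Valid (Δ ∷ G)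
  Valid-head Γ≡Δ valid v (Δ<0 ∷ ρ) = valid v (subst (_< 0#) (≡.sym (Γ≡Δ v)) Δ<0 ∷ ρ)

  -- Each premise sequent is bounded by the conclusion sequent, so if the latter is negative then
  -- both of the former are.
  Valid-join⁺ : ∀ {G} Γ rs A B → Valid ((Γ ++ rs ∙ A) ∷ (Γ ++ rs ∙ B) ∷ G) →
                Valid ((Γ ++ rs ∙ (A ⊔ B)) ∷ G)
  Valid-join⁺ Γ rs A B valid v (p ∷ ρ) = valid v
    ( ≤-<-trans (eval-mono v Γ rs A (A ⊔ B) (x≤max (⟦ A ⟧ v) (⟦ B ⟧ v))) p
    ∷ ≤-<-trans (eval-mono v Γ rs B (A ⊔ B) (y≤max (⟦ A ⟧ v) (⟦ B ⟧ v))) p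
    ∷ ρ)

  -- At a given valuation the join equals one of its two arguments, and the sequent with that
  -- argument has the value of the joined sequent.
  Valid-join⁻ : ∀ {G} Γ rs A B → Valid ((Γ ++ rs ∙ (A ⊔ B)) ∷ G) →
                Valid ((Γ ++ rs ∙ A) ∷ (Γ ++ rs ∙ B) ∷ G)
  Valid-join⁻ Γ rs A B valid v (p ∷ q ∷ ρ) with max-sel (⟦ A ⟧ v) (⟦ B ⟧ v)
  ... | inj₁ max≡A = valid v (subst (_< 0#) (eval-cong v Γ rs A (A ⊔ B) (≡.sym max≡A)) p ∷ ρ)
  ... | inj₂ max≡B = valid v (subst (_< 0#) (eval-cong v Γ rs B (A ⊔ B) (≡.sym max≡B)) q ∷ ρ)

  Valid-meet⁺ : ∀ {G} Γ rs A B → Valid ((Γ ++ rs ∙ A) ∷ G) → Valid ((Γ ++ rs ∙ B) ∷ G) →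
                Valid ((Γ ++ rs ∙ (A ⊓ B)) ∷ G)
  Valid-meet⁺ Γ rs A B validA validB v (p ∷ ρ) with min-sel (⟦ A ⟧ v) (⟦ B ⟧ v)
  ... | inj₁ min≡A = validA v (subst (_< 0#) (eval-cong v Γ rs (A ⊓ B) A min≡A) p ∷ ρ)
  ... | inj₂ min≡B = validB v (subst (_< 0#) (eval-cong v Γ rs (A ⊓ B) B min≡B) p ∷ ρ)

  Valid-meet⁻ˡ : ∀ {G} Γ rs A B → Valid ((Γ ++ rs ∙ (A ⊓ B)) ∷ G) → Valid ((Γ ++ rs ∙ A) ∷ G)
  Valid-meet⁻ˡ Γ rs A B valid v (p ∷ ρ) =
    valid v (≤-<-trans (eval-mono v Γ rs (A ⊓ B) A (min≤x (⟦ A ⟧ v) (⟦ B ⟧ v))) p ∷ ρ)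

  Valid-meet⁻ʳ : ∀ {G} Γ rs A B → Valid ((Γ ++ rs ∙ (A ⊓ B)) ∷ G) → Valid ((Γ ++ rs ∙ B) ∷ G)
  Valid-meet⁻ʳ Γ rs A B valid v (p ∷ ρ) =
    valid v (≤-<-trans (eval-mono v Γ rs (A ⊓ B) B (min≤y (⟦ A ⟧ v) (⟦ B ⟧ v))) p ∷ ρ)

  -- A valuation refuting the conclusion of a rule refutes one of its premises. The flag is
  -- arbitrary, so derivations with CAN are covered.
  sound : ∀ {b G} → Der b G → Valid G
  sound (ex-H p d) = Valid-↭ p (sound d)
  sound (ex-S p d) = Valid-head (λ v → eval-↭ v p) (sound d)
  sound INIT v (0<0 ∷ []) = <-irrefl ≡.refl 0<0
  sound (W d) v (_ ∷ ρ) = sound d v ρ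
  sound (C d) v (p ∷ ρ) = sound d v (p ∷ p ∷ ρ)
  sound (S {Γ₁ = Γ₁} {Γ₂} d) v (p ∷ q ∷ ρ) =
    sound d v (subst (_< 0#) (≡.sym (eval-++ v Γ₁ Γ₂)) (+-neg p q) ∷ ρ)
  -- A negative sum has a negative summand, which selects the premise to contradict.
  sound (M {Γ₁ = Γ₁} {Γ₂} d e) v (p ∷ ρ)
    with sum<0⇒ (eval v Γ₁) (eval v Γ₂) (subst (_< 0#) (eval-++ v Γ₁ Γ₂) p)
  ... | inj₁ Γ₁<0 = sound d v (Γ₁<0 ∷ ρ)
  ... | inj₂ Γ₂<0 = sound e v (Γ₂<0 ∷ ρ)
  sound (Tr {Γ = Γ} r d) v (p ∷ ρ) =
    sound d v (subst (_< 0#) (≡.sym (eval-scaleS v r Γ)) (*-pos-neg (0<val r) p) ∷ ρ)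
  sound (ID {Γ = Γ} rs ss x rs≡ss d) =
    Valid-head (λ v → ≡.sym (eval-ID v Γ rs ss x rs≡ss)) (sound d)
  sound (Z {Γ = Γ} rs d) = Valid-head (λ v → ≡.sym (eval-Z v Γ rs)) (sound d)
  sound (plus {Γ = Γ} rs A B d) = Valid-head (λ v → eval-plus v Γ rs A B) (sound d)
  sound (times {Γ = Γ} rs s A d) = Valid-head (λ v → eval-times v Γ rs s A) (sound d)
  sound (join {Γ = Γ} rs A B d) = Valid-join⁺ Γ rs A B (sound d)
  sound (meet {Γ = Γ} rs A B d e) = Valid-meet⁺ Γ rs A B (sound d) (sound e)
  sound (CAN {Γ = Γ} _ rs ss A rs≡ss d) = Valid-head (λ v → eval-CAN v Γ rs ss A rs≡ss) (sound d)

-- Contraction and weakening in the CAN-free calculus.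

module Completeness (ℝ : Reals) where
  open OrderedField ℝ
  open HR ℝ
  open Semantics ℝ

  private
    D : Hypersequent → Set
    D = CANfreeDerivable

  absorb : ∀ {Γ H} → Γ ∈ H → D (Γ ∷ H) → D H
  absorb {Γ} Γ∈H d with ∈-∃++ Γ∈H
  ... | as , bs , ≡.refl =
    ex-H (↭-sym (shift Γ as bs)) (C (ex-H (prep Γ (shift Γ as bs)) d))

  weaken : ∀ {G} H → D G → D (H ++ G)
  weaken [] d = d
  weaken (Γ ∷ H) d = W (weaken H d)

  -- Quantifying over all `H` that contain `G` lets sequents be absorbed one at a time while the
  -- others are still present in `H`.
  Absorbable : Hypersequent → Sequent → Set
  Absorbable G Γ = ∀ {H} → G ⊆ H → D (Γ ∷ H) → D H

  absorb-all : ∀ {G G' H} → All (Absorbable G) G' → G ⊆ H → D (G' ++ H) → D H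
  absorb-all [] G⊆H d = d
  absorb-all {G' = _ ∷ G'} (α ∷ αs) G⊆H d = absorb-all αs G⊆H (α (∈-++⁺ʳ G' ∘ G⊆H) d)

  -- Sequents of literals as linear forms.

  data Literal (n : ℕ) : Term → Set where
    var   : ∀ {x} → x ℕ.< n → Literal n (var x)
    covar : ∀ {x} → x ℕ.< n → Literal n (covar x)

  -- Variable elimination is an induction on this bound. At bound 0 only the empty sequent is left.
  Below : ℕ → Sequent → Set
  Below n = All (Literal n ∘ proj₂)

  Below-scaleS : ∀ {n} s {Γ} → Below n Γ → Below n (scaleS s Γ)
  Below-scaleS s [] = []
  Below-scaleS s (l ∷ ls) = l ∷ Below-scaleS s ls

  δ : ℕ → Valuation
  δ n x with x ℕ.≟ n
  ... | yes _ = 1#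
  ... | no _  = 0#

  δ-diag : ∀ n → δ n n ≡ 1#
  δ-diag n with n ℕ.≟ n
  ... | yes _   = ≡.refl
  ... | no n≢n = ⊥-elim (n≢n ≡.refl)

  δ-below : ∀ {n x} → x ℕ.< n → δ n x ≡ 0#
  δ-below {n} {x} x<n with x ℕ.≟ n
  ... | yes x≡n = ⊥-elim (ℕₚ.<⇒≢ x<n x≡n)
  ... | no _    = ≡.refl

  -- On literals `eval` is linear in the valuation, so its value at the unit vector `δ n` is the
  -- coefficient of variable `n`. All the lemmas about `eval` thus apply to coefficients.
  coef : ℕ → Sequent → Carrier
  coef n = eval (δ n)

  coef-below : ∀ {n Γ} → Below n Γ → coef n Γ ≡ 0#
  coef-below [] = ≡.refl
  coef-below {Γ = (r , _) ∷ _} (var x<n ∷ ls) = ≡.trans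
    (cong₂ _+_ (≡.trans (cong (val r *_) (δ-below x<n)) (zeroʳ (val r))) (coef-below ls))
    (+-identityʳ 0#)
  coef-below {Γ = (r , _) ∷ _} (covar x<n ∷ ls) = ≡.trans
    (cong₂ _+_ (≡.trans (cong (val r *_) (≡.trans (cong -_ (δ-below x<n)) -0#≈0#)) (zeroʳ (val r)))
               (coef-below ls))
    (+-identityʳ 0#)

  -- Literals are linear in the valuation, while joins and meets are not. With `w = δ n` this gives
  -- the effect of moving the value of variable `n` by `t`.
  eval-linear : ∀ {n Γ} v t w → Below n Γ →
                eval (λ x → v x + t * w x) Γ ≡ eval v Γ + t * eval w Γ
  eval-linear v t w [] = ≡.sym (≡.trans (+-identityˡ (t * 0#)) (zeroʳ t))
  eval-linear {Γ = (r , var x) ∷ Γ} v t w (var _ ∷ ls) = ≡.trans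
    (cong (val r * (v x + t * w x) +_) (eval-linear v t w ls))
    (solve 6 (λ r a t b e f → r :* (a :+ t :* b) :+ (e :+ t :* f) := r :* a :+ e :+ t :* (r :* b :+ f))
      ≡.refl (val r) (v x) t (w x) (eval v Γ) (eval w Γ))
  -- Negation is pushed down to `v x` and `w x`, after which the semiring identity of the positive
  -- case applies to `- v x` and `- w x`.
  eval-linear {Γ = (r , covar x) ∷ Γ} v t w (covar _ ∷ ls) = ≡.trans
    (cong₂ (λ a e → val r * a + e)
      (≡.trans (≡.sym (-‿+-comm (v x) (t * w x))) (cong (- v x +_) (-‿distribʳ-* t (w x))))
      (eval-linear v t w ls))
    (solve 6 (λ r a t b e f → r :* (a :+ t :* b) :+ (e :+ t :* f) := r :* a :+ e :+ t :* (r :* b :+ f))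
      ≡.refl (val r) (- v x) t (- w x) (eval v Γ) (eval w Γ))

  -- Gathers the occurrences of variable `n` in the shape of the conclusion of ID.
  extract-var : ∀ n {Γ} → Below (suc n) Γ → Σ Sequent λ Δ → Σ Vect λ rs → Σ Vect λ ss →
                Below n Δ × Γ ↭ Δ ++ rs ∙ var n ++ ss ∙ covar n
  extract-var n [] = [] , [] , [] , [] , refl
  extract-var n {(r , var x) ∷ Γ} (var x<1+n ∷ ls) with extract-var n ls | x ℕ.≟ n
  ... | Δ , rs , ss , Δ<n , p | yes ≡.refl =
        Δ , r ∷ rs , ss , Δ<n , trans (prep _ p) (↭-sym (shift _ Δ _))
  ... | Δ , rs , ss , Δ<n , p | no x≢n =
        (r , var x) ∷ Δ , rs , ss , var (ℕₚ.≤∧≢⇒< (ℕₚ.≤-pred x<1+n) x≢n) ∷ Δ<n , prep _ p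
  extract-var n {(r , covar x) ∷ Γ} (covar x<1+n ∷ ls) with extract-var n ls | x ℕ.≟ n
  ... | Δ , rs , ss , Δ<n , p | yes ≡.refl =
        Δ , rs , r ∷ ss , Δ<n ,
        trans (prep _ p) (trans (↭-sym (shift _ Δ _)) (++⁺ˡ Δ (↭-sym (shift _ (rs ∙ var n) _))))
  ... | Δ , rs , ss , Δ<n , p | no x≢n =
        (r , covar x) ∷ Δ , rs , ss , covar (ℕₚ.≤∧≢⇒< (ℕₚ.≤-pred x<1+n) x≢n) ∷ Δ<n , prep _ p

  coef-extracted : ∀ n {Δ} rs ss → Below n Δ →
                   coef n (Δ ++ rs ∙ var n ++ ss ∙ covar n) ≡ Σv rs + - Σv ss
  coef-extracted n {Δ} rs ss Δ<n = begin
    coef n (Δ ++ rs ∙ var n ++ ss ∙ covar n)                      ≡⟨ eval-++ (δ n) Δ _ ⟩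
    coef n Δ + coef n (rs ∙ var n ++ ss ∙ covar n)                ≡⟨ cong₂ _+_ (coef-below Δ<n) (eval-++-∙ (δ n) (rs ∙ var n) ss (covar n)) ⟩
    0# + (coef n (rs ∙ var n) + Σv ss * - δ n n)                  ≡⟨ +-identityˡ _ ⟩
    coef n (rs ∙ var n) + Σv ss * - δ n n                         ≡⟨ cong₂ _+_ (eval-∙ (δ n) rs (var n)) (≡.sym (-‿distribʳ-* (Σv ss) (δ n n))) ⟩
    Σv rs * δ n n + - (Σv ss * δ n n)                             ≡⟨ cong (λ d → Σv rs * d + - (Σv ss * d)) (δ-diag n) ⟩
    Σv rs * 1# + - (Σv ss * 1#)                                   ≡⟨ cong₂ (λ a b → a + - b) (*-identityʳ (Σv rs)) (*-identityʳ (Σv ss)) ⟩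
    Σv rs + - Σv ss                                               ∎
    where open ≡.≡-Reasoning

  -- A zero coefficient is exactly the side condition `Σv rs ≡ Σv ss` of ID. The equality of values
  -- carries refutations back, ID carries derivations back.
  cancel-var : ∀ n {Γ} → Below (suc n) Γ → coef n Γ ≡ 0# → Σ Sequent λ Δ →
               Below n Δ × (∀ v → eval v Γ ≡ eval v Δ) × (∀ {G} → D (Δ ∷ G) → D (Γ ∷ G))
  cancel-var n Γ<1+n c≡0 with extract-var n Γ<1+n
  ... | Δ , rs , ss , Δ<n , p =
        Δ , Δ<n
      , (λ v → ≡.trans (eval-↭ v p) (eval-ID v Δ rs ss n rs≡ss))
      , (λ d → ex-S (↭-sym p) (ID rs ss n rs≡ss d))
    where
    rs≡ss : Σv rs ≡ Σv ss
    rs≡ss = x∙y⁻¹≈ε⇒x≈y (Σv rs) (Σv ss)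
      (≡.trans (≡.sym (coef-extracted n rs ss Δ<n)) (≡.trans (≡.sym (eval-↭ (δ n) p)) c≡0))

  cancel-var-all : ∀ n {G} → All (λ Γ → Below (suc n) Γ × coef n Γ ≡ 0#) G → Σ Hypersequent λ G' →
                   All (Below n) G' × (∀ v → Refutes v G' → Refutes v G) ×
                   (∀ {H} → D (G' ++ H) → D (G ++ H))
  cancel-var-all n [] = [] , [] , (λ _ ρ → ρ) , (λ d → d)
  cancel-var-all n {Γ ∷ G} ((Γ<1+n , c≡0) ∷ rest)
    with cancel-var n Γ<1+n c≡0 | cancel-var-all n rest
  ... | Δ , Δ<n , Γ≡Δ , derΓ | G' , G'<n , refG , derG =
        Δ ∷ G' , Δ<n ∷ G'<n
      , (λ { v (p ∷ ρ) → subst (_< 0#) (≡.sym (Γ≡Δ v)) p ∷ refG v ρ })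
      -- The side part `H` is variable so that `Γ` can be parked in it while the tail is treated.
      , (λ {H} d → ex-H (shift Γ G H) (derG (ex-H (↭-sym (shift Γ G' H)) (derΓ d))))

  -- The value 1 for c ≤ 0 is junk.
  clamp : Carrier → ℝ⁺
  clamp c with 0# <? c
  ... | yes 0<c = mk⁺ c 0<c
  ... | no _    = mk⁺ 1# 0<1

  val-clamp : ∀ {c} → 0# < c → val (clamp c) ≡ c
  val-clamp {c} 0<c with 0# <? c
  ... | yes _   = ≡.refl
  ... | no 0≮c = ⊥-elim (0≮c 0<c)

  -- Fourier-Motzkin elimination of one variable.

  root : ∀ c e → Σ Carrier λ q → c ≢ 0# → e + c * q ≡ 0#
  root c e with c ≟ 0#
  -- A default value, which makes the root a total function of `c` and `e`.
  ... | yes c≡0 = 0# , λ c≢0 → ⊥-elim (c≢0 c≡0)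
  ... | no c≢0 with inverse c c≢0
  ...   | c⁻¹ , cc⁻¹≡1 = c⁻¹ * - e , λ _ → ≡.trans
          (cong (e +_) (≡.trans (≡.sym (*-assoc c c⁻¹ (- e)))
            (≡.trans (cong (_* - e) cc⁻¹≡1) (*-identityˡ (- e)))))
          (-‿inverseʳ e)

  -- Substituting `- (c * p)` for `e` and `- (d * q)` for `f` turns the negative combination into
  -- `- d * c` times `q + - p`, and `- d * c` is positive.
  root-< : ∀ {c d e f p q} → 0# < c → d < 0# → e + c * p ≡ 0# → f + d * q ≡ 0# →
           - d * e + c * f < 0# → q < p
  root-< {c} {d} {e} {f} {p} {q} 0<c d<0 e+cp≡0 f+dq≡0 comb<0 =
    *-cancelˡ-< (*-pos (x<0⇒0<-x d<0) 0<c) (begin-strict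
      a * c * q                          ≡⟨ +-identityˡ (a * c * q) ⟨
      0# + a * c * q                     ≡⟨ cong (_+ a * c * q) (≡.trans (cong (c *_) f+dq≡0) (zeroʳ c)) ⟨
      c * (f + d * q) + a * c * q        ≡⟨ solve 5 (λ a c d f q → c :* (f :+ d :* q) :+ a :* c :* q := c :* f :+ c :* (a :+ d) :* q) ≡.refl a c d f q ⟩
      c * f + c * (a + d) * q            ≡⟨ cong (c * f +_) (≡.trans (cong (λ z → c * z * q) (-‿inverseˡ d)) (≡.trans (cong (_* q) (zeroʳ c)) (zeroˡ q))) ⟩
      c * f + 0#                         ≡⟨ cong (c * f +_) (≡.trans (cong (a *_) e+cp≡0) (zeroʳ a)) ⟨
      c * f + a * (e + c * p)            ≡⟨ solve 5 (λ a c e f p → c :* f :+ a :* (e :+ c :* p) := (a :* e :+ c :* f) :+ a :* c :* p) ≡.refl a c e f p ⟩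
      (a * e + c * f) + a * c * p        <⟨ +-mono-< (a * c * p) comb<0 ⟩
      0# + a * c * p                     ≡⟨ +-identityˡ (a * c * p) ⟩
      a * c * p                          ∎)
    where
    open <-Reasoning
    a : Carrier
    a = - d

  -- As a function of `t` the expression decreases for negative `c` and increases for positive `c`,
  -- vanishing at `q` in both cases; for `c ≡ 0#` it is constantly `e`.
  affine<0 : ∀ {c e q t} → (c ≢ 0# → e + c * q ≡ 0#) → (c < 0# → q < t) → (0# < c → t < q) →
             (c ≡ 0# → e < 0#) → e + c * t < 0#
  affine<0 {c} {e} {q} {t} e+cq≡0 above below constant with compare c 0#
  ... | tri< c<0 c≢0 _ = subst (e + c * t <_) (e+cq≡0 c≢0)
        (+-monoʳ-< e (*-antimonoˡ-< c<0 (above c<0)))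
  ... | tri≈ _ ≡.refl _ = subst (_< 0#)
        (≡.sym (≡.trans (cong (e +_) (zeroˡ t)) (+-identityʳ e))) (constant ≡.refl)
  ... | tri> _ c≢0 0<c = subst (e + c * t <_) (e+cq≡0 c≢0)
        (+-monoʳ-< e (*-monoˡ-< 0<c (below 0<c)))

  -- Intended for `Γ` with positive and `Δ` with negative coefficient: there `clamp` returns its
  -- argument and the coefficients of `n` cancel.
  combine : ℕ → Sequent → Sequent → Sequent
  combine n Γ Δ = scaleS (clamp (- coef n Δ)) Γ ++ scaleS (clamp (coef n Γ)) Δ

  eval-combine : ∀ n v Γ Δ → 0# < coef n Γ → coef n Δ < 0# →
                 eval v (combine n Γ Δ) ≡ - coef n Δ * eval v Γ + coef n Γ * eval v Δ
  eval-combine n v Γ Δ 0<c d<0 = ≡.trans (eval-++ v (scaleS (clamp (- coef n Δ)) Γ) _) (cong₂ _+_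
    (≡.trans (eval-scaleS v (clamp (- coef n Δ)) Γ) (cong (_* eval v Γ) (val-clamp (x<0⇒0<-x d<0))))
    (≡.trans (eval-scaleS v (clamp (coef n Γ)) Δ) (cong (_* eval v Δ) (val-clamp 0<c))))

  coef-combine : ∀ n Γ Δ → 0# < coef n Γ → coef n Δ < 0# → coef n (combine n Γ Δ) ≡ 0#
  coef-combine n Γ Δ 0<c d<0 = begin
    coef n (combine n Γ Δ)      ≡⟨ eval-combine n (δ n) Γ Δ 0<c d<0 ⟩
    - d * c + c * d             ≡⟨ cong (_+ c * d) (*-comm (- d) c) ⟩
    c * - d + c * d             ≡⟨ distribˡ c (- d) d ⟨
    c * (- d + d)               ≡⟨ cong (c *_) (-‿inverseˡ d) ⟩
    c * 0#                      ≡⟨ zeroʳ c ⟩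
    0#                          ∎
    where
    open ≡.≡-Reasoning
    c d : Carrier
    c = coef n Γ
    d = coef n Δ

  -- From the inside out: S separates the two scaled parts, T undoes each scaling, and each part is
  -- then contracted with its copy in `H`. Weights from `clamp` are always positive, as T demands.
  combine-absorbable : ∀ {n G Γ Δ} → Γ ∈ G → Δ ∈ G → Absorbable G (combine n Γ Δ)
  combine-absorbable {n} {Γ = Γ} {Δ} Γ∈G Δ∈G G⊆H d =
    absorb (G⊆H Δ∈G) (Tr (clamp (coef n Γ))
      (absorb (there (G⊆H Γ∈G)) (Tr (clamp (- coef n Δ)) (S d))))

  module Eliminate (n : ℕ) (G : Hypersequent) where

    positive negative neutral eliminated : Hypersequent
    positive   = filter (λ Γ → 0# <? coef n Γ) G
    negative   = filter (λ Γ → coef n Γ <? 0#) G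
    neutral    = filter (λ Γ → coef n Γ ≟ 0#) G
    eliminated = cartesianProductWith (combine n) positive negative ++ neutral

    positive⁺ : ∀ {Γ} → Γ ∈ G → 0# < coef n Γ → Γ ∈ positive
    positive⁺ = ∈-filter⁺ (λ Γ → 0# <? coef n Γ)

    negative⁺ : ∀ {Γ} → Γ ∈ G → coef n Γ < 0# → Γ ∈ negative
    negative⁺ = ∈-filter⁺ (λ Γ → coef n Γ <? 0#)

    neutral⁺ : ∀ {Γ} → Γ ∈ G → coef n Γ ≡ 0# → Γ ∈ neutral
    neutral⁺ = ∈-filter⁺ (λ Γ → coef n Γ ≟ 0#)

    positive⁻ : ∀ {Γ} → Γ ∈ positive → Γ ∈ G × 0# < coef n Γ
    positive⁻ = ∈-filter⁻ (λ Γ → 0# <? coef n Γ) {xs = G}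

    negative⁻ : ∀ {Γ} → Γ ∈ negative → Γ ∈ G × coef n Γ < 0#
    negative⁻ = ∈-filter⁻ (λ Γ → coef n Γ <? 0#) {xs = G}

    neutral⁻ : ∀ {Γ} → Γ ∈ neutral → Γ ∈ G × coef n Γ ≡ 0#
    neutral⁻ = ∈-filter⁻ (λ Γ → coef n Γ ≟ 0#) {xs = G}

    combine∈ : ∀ {Γ Δ} → Γ ∈ positive → Δ ∈ negative → combine n Γ Δ ∈ eliminated
    combine∈ Γ∈ Δ∈ = ∈-++⁺ˡ (∈-cartesianProductWith⁺ (combine n) Γ∈ Δ∈)

    neutral∈ : ∀ {Γ} → Γ ∈ neutral → Γ ∈ eliminated
    neutral∈ = ∈-++⁺ʳ (cartesianProductWith (combine n) positive negative)

    eliminated-elim : (P : Sequent → Set) →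
      (∀ {Γ Δ} → Γ ∈ G → Δ ∈ G → 0# < coef n Γ → coef n Δ < 0# → P (combine n Γ Δ)) →
      (∀ {Γ} → Γ ∈ G → coef n Γ ≡ 0# → P Γ) → All P eliminated
    eliminated-elim P combined kept = Allₚ.++⁺ (All.tabulate on-products) (All.tabulate on-neutral)
      where
      on-products : ∀ {Θ} → Θ ∈ cartesianProductWith (combine n) positive negative → P Θ
      on-products Θ∈ with ∈-cartesianProductWith⁻ (combine n) positive negative Θ∈
      ... | Γ , Δ , Γ∈ , Δ∈ , ≡.refl with positive⁻ Γ∈ | negative⁻ Δ∈
      ...   | Γ∈G , 0<c | Δ∈G , d<0 = combined Γ∈G Δ∈G 0<c d<0
      on-neutral : ∀ {Θ} → Θ ∈ neutral → P Θ
      on-neutral Θ∈ with neutral⁻ Θ∈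
      ... | Θ∈G , c≡0 = kept Θ∈G c≡0

    eliminated-absorbable : All (Absorbable G) eliminated
    eliminated-absorbable = eliminated-elim (Absorbable G)
      (λ Γ∈G Δ∈G _ _ → combine-absorbable {n} Γ∈G Δ∈G) (λ Γ∈G _ G⊆H → absorb (G⊆H Γ∈G))

    eliminated-reducible : All (Below (suc n)) G →
                           All (λ Γ → Below (suc n) Γ × coef n Γ ≡ 0#) eliminated
    eliminated-reducible G<1+n = eliminated-elim _
      (λ {Γ} {Δ} Γ∈G Δ∈G 0<c d<0 →
          Allₚ.++⁺ (Below-scaleS (clamp (- coef n Δ)) (All.lookup G<1+n Γ∈G))
                   (Below-scaleS (clamp (coef n Γ)) (All.lookup G<1+n Δ∈G))
        , coef-combine n Γ Δ 0<c d<0)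
      (λ Γ∈G c≡0 → All.lookup G<1+n Γ∈G , c≡0)

    module Extend {v : Valuation} (ρ : Refutes v eliminated) where

      -- The shift of variable `n` that brings the value of the sequent to zero: an upper bound on
      -- admissible shifts if the coefficient is positive, a lower bound if it is negative.
      threshold : Sequent → Carrier
      threshold Γ = proj₁ (root (coef n Γ) (eval v Γ))

      at-threshold : ∀ Γ → coef n Γ ≢ 0# → eval v Γ + coef n Γ * threshold Γ ≡ 0#
      at-threshold Γ = proj₂ (root (coef n Γ) (eval v Γ))

      -- The combination of `Γ` and `Δ` belongs to `eliminated`, so `v` makes it negative, which is
      -- the last hypothesis of `root-<`.
      threshold-< : ∀ {Γ Δ} → Γ ∈ positive → Δ ∈ negative → threshold Δ < threshold Γ
      threshold-< {Γ} {Δ} Γ∈ Δ∈ = root-< 0<c d<0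
        (at-threshold Γ (λ c≡0 → <-irrefl (≡.sym c≡0) 0<c))
        (at-threshold Δ (λ d≡0 → <-irrefl d≡0 d<0))
        (subst (_< 0#) (eval-combine n v Γ Δ 0<c d<0) (All.lookup ρ (combine∈ Γ∈ Δ∈)))
        where
        0<c : 0# < coef n Γ
        0<c = proj₂ (positive⁻ Γ∈)
        d<0 : coef n Δ < 0#
        d<0 = proj₂ (negative⁻ Δ∈)

      shifted : ∀ {Γ} t → (Γ ∈ negative → threshold Γ < t) → (Γ ∈ positive → t < threshold Γ) →
                Γ ∈ G → eval v Γ + coef n Γ * t < 0#
      shifted {Γ} t above below Γ∈G = affine<0 (at-threshold Γ)
        (above ∘ negative⁺ Γ∈G) (below ∘ positive⁺ Γ∈G) (All.lookup ρ ∘ neutral∈ ∘ neutral⁺ Γ∈G)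

      shift-refutes : ∀ t → All (_< t) (map threshold negative) → All (t <_) (map threshold positive) →
                      All (Below (suc n)) G → Refutes (λ x → v x + t * δ n x) G
      shift-refutes t above below G<1+n = All.tabulate λ {Γ} Γ∈G →
        subst (_< 0#)
          (≡.sym (≡.trans (eval-linear v t (δ n) (All.lookup G<1+n Γ∈G))
            (cong (eval v Γ +_) (*-comm t (coef n Γ)))))
          (shifted t (All.lookup (Allₚ.map⁻ above)) (All.lookup (Allₚ.map⁻ below)) Γ∈G)

      thresholds-separated : All (λ l → All (l <_) (map threshold positive)) (map threshold negative)
      thresholds-separated =
        Allₚ.map⁺ (All.tabulate λ Δ∈ → Allₚ.map⁺ (All.tabulate λ Γ∈ → threshold-< Γ∈ Δ∈))

      extend-refutation : All (Below (suc n)) G → ∃ λ w → Refutes w G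
      extend-refutation G<1+n =
        let t , above , below = interpolate _ _ thresholds-separated
        in _ , shift-refutes t above below G<1+n

  -- Induction on the number of variables. A refutation found after elimination is extended to
  -- variable `n`; a derivation is replayed back to `G`.
  refute-or-derive : ∀ n {G} → All (Below n) G → (∃ λ v → Refutes v G) ⊎ D G
  refute-or-derive zero [] = inj₁ ((λ _ → 0#) , [])
  -- Without variables the head sequent is empty, so INIT and W suffice.
  refute-or-derive zero {_ ∷ G} ([] ∷ _) = inj₂ (ex-H (++-comm G ([] ∷ [])) (weaken G INIT))
  refute-or-derive zero ((var () ∷ _) ∷ _)
  refute-or-derive zero ((covar () ∷ _) ∷ _)
  refute-or-derive (suc n) {G} G<1+n with cancel-var-all n (eliminated-reducible G<1+n)
    where open Eliminate n G
  ... | G' , G'<n , refG , derG with refute-or-derive n G'<n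
  ...   | inj₁ (v , ρ) = inj₁ (Eliminate.Extend.extend-refutation n G (refG v ρ) G<1+n)
  -- Weakening adds `G` next to `G'`, `derG` turns `G'` into the eliminated sequents, and these are
  -- all absorbed into `G`.
  ...   | inj₂ d = inj₂ (absorb-all (Eliminate.eliminated-absorbable n G) (λ Γ∈G → Γ∈G)
                     (derG (ex-H (++-comm G G') (weaken G d))))

  -- Reduction of arbitrary hypersequents to literals.

  Complete : Hypersequent → Set
  Complete G = Valid G → D G

  Complete-↭ : ∀ {G H} → G ↭ H → Complete G → Complete H
  Complete-↭ p complete valid = ex-H p (complete (Valid-↭ (↭-sym p) valid))

  Literals : Sequent → Set
  Literals = All (λ w → ∃ λ n → Literal n (proj₂ w))

  -- Takes the maximum of the bounds. It serves twice: for the literals of one sequent, then for the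
  -- sequents of a hypersequent.
  uniform-bound : ∀ {A : Set} {P : ℕ → A → Set} →
                  (∀ {m n x} → m ℕ.≤ n → P m x → P n x) →
                  ∀ {xs} → All (λ x → ∃ λ n → P n x) xs → ∃ λ n → All (P n) xs
  uniform-bound mono [] = 0 , []
  uniform-bound mono ((m , p) ∷ ps) with uniform-bound mono ps
  ... | n , qs = m ℕ.⊔ n , mono (ℕₚ.m≤m⊔n m n) p ∷ All.map (mono (ℕₚ.m≤n⊔m m n)) qs

  Literal-mono : ∀ {m n A} → m ℕ.≤ n → Literal m A → Literal n A
  Literal-mono m≤n (var x<m) = var (ℕₚ.<-≤-trans x<m m≤n)
  Literal-mono m≤n (covar x<m) = covar (ℕₚ.<-≤-trans x<m m≤n)

  complete-literals : ∀ {G} → All Literals G → Complete G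
  complete-literals G-lit valid
    with uniform-bound (λ m≤n → All.map (Literal-mono m≤n)) (All.map (uniform-bound Literal-mono) G-lit)
  ... | n , G<n with refute-or-derive n G<n
  ...   | inj₁ (v , ρ) = ⊥-elim (valid v ρ)
  ...   | inj₂ d = d

  LiterallyComplete : Hypersequent → Set
  LiterallyComplete G = ∀ {Λs} → All Literals Λs → Complete (Λs ++ G)

  -- The side hypersequent G is arbitrary because the join rule duplicates the
  -- sequent it decomposes: the two copies are reduced to literals one after the other.
  Reducible : Sequent → Set
  Reducible Γ = ∀ {G} → LiterallyComplete G → Complete (Γ ∷ G)

  -- `Γ` is reduced with `Λs ++ G` as its side hypersequent; the literal sequents this yields simply
  -- join `Λs`.
  LiterallyComplete-∷ : ∀ {Γ G} → Reducible Γ → LiterallyComplete G → LiterallyComplete (Γ ∷ G)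
  LiterallyComplete-∷ {Γ} {G} red lc {Λs} Λs-lit = Complete-↭ (↭-sym (shift Γ Λs G))
    (red λ {Λs'} Λs'-lit →
      subst Complete (++-assoc Λs' Λs G) (lc (Allₚ.++⁺ Λs'-lit Λs-lit)))

  Reducible-↭ : ∀ {Γ Δ} → Γ ↭ Δ → Reducible Γ → Reducible Δ
  Reducible-↭ p red lc valid =
    ex-S p (red lc (Valid-head (λ v → eval-↭ v (↭-sym p)) valid))

  reducible-literals : ∀ {Λ} → Literals Λ → Reducible Λ
  reducible-literals Λ-lit lc = lc (Λ-lit ∷ [])

  -- Structural induction on `A`. The hypothesis on `Γ` allows any literals `Λ`, since a sum breaks
  -- up into several literals within one sequent.
  reducible-term : ∀ A r Γ → (∀ {Λ} → Literals Λ → Reducible (Γ ++ Λ)) →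
                   Reducible (Γ ++ (r , A) ∷ [])
  reducible-term (var x) r Γ red = red ((suc x , var ℕₚ.≤-refl) ∷ [])
  reducible-term (covar x) r Γ red = red ((suc x , covar ℕₚ.≤-refl) ∷ [])
  reducible-term zero r Γ red lc valid = Z (r ∷ [])
    (subst Reducible (++-identityʳ Γ) (red []) lc (Valid-head (λ v → eval-Z v Γ (r ∷ [])) valid))
  reducible-term (A ⊕ B) r Γ red lc valid = plus (r ∷ []) A B
    (redAB lc (Valid-head (λ v → ≡.sym (eval-plus v Γ (r ∷ []) A B)) valid))
    where
    redAB : Reducible (Γ ++ (r , A) ∷ (r , B) ∷ [])
    redAB = subst Reducible (++-assoc Γ ((r , A) ∷ []) ((r , B) ∷ []))
      -- `B` is decomposed first, with `A` in the context. Then `A` is moved past the literals `Λ`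
      -- of `B` and decomposed, and both groups of literals are handed to `red`.
      (reducible-term B r (Γ ++ (r , A) ∷ []) λ {Λ} Λ-lit →
        Reducible-↭ (trans (↭-reflexive (++-assoc Γ Λ _)) (trans (++⁺ˡ Γ (++-comm Λ _))
                      (↭-sym (↭-reflexive (++-assoc Γ _ Λ)))))
          (reducible-term A r (Γ ++ Λ) λ {Λ'} Λ'-lit →
            subst Reducible (≡.sym (++-assoc Γ Λ Λ')) (red (Allₚ.++⁺ Λ-lit Λ'-lit))))
  reducible-term (s · A) r Γ red lc valid = times (r ∷ []) s A
    (reducible-term A (s *⁺ r) Γ red lc
      (Valid-head (λ v → ≡.sym (eval-times v Γ (r ∷ []) s A)) valid))
  reducible-term (A ⊔ B) r Γ red lc valid = join (r ∷ []) A B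
    -- The copy with `B` goes into the side hypersequent, where the induction hypothesis for `B`
    -- keeps literal completeness.
    (reducible-term A r Γ red (LiterallyComplete-∷ (reducible-term B r Γ red) lc)
      (Valid-join⁻ Γ (r ∷ []) A B valid))
  reducible-term (A ⊓ B) r Γ red lc valid = meet (r ∷ []) A B
    (reducible-term A r Γ red lc (Valid-meet⁻ˡ Γ (r ∷ []) A B valid))
    (reducible-term B r Γ red lc (Valid-meet⁻ʳ Γ (r ∷ []) A B valid))

  -- Terms of `Γ` are moved to the end and decomposed one by one, `Λ` accumulating the literals
  -- obtained.
  reducible-++ : ∀ Γ {Λ} → Literals Λ → Reducible (Γ ++ Λ)
  reducible-++ [] Λ-lit = reducible-literals Λ-lit
  reducible-++ ((r , A) ∷ Γ) {Λ} Λ-lit = Reducible-↭ (++-comm (Γ ++ Λ) ((r , A) ∷ []))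
    (reducible-term A r (Γ ++ Λ) λ {Λ'} Λ'-lit →
      subst Reducible (≡.sym (++-assoc Γ Λ Λ')) (reducible-++ Γ (Allₚ.++⁺ Λ-lit Λ'-lit)))

  reducible : ∀ Γ → Reducible Γ
  reducible Γ = subst Reducible (++-identityʳ Γ) (reducible-++ Γ [])

  literally-complete : ∀ G → LiterallyComplete G
  literally-complete [] {Λs} Λs-lit = subst Complete (≡.sym (++-identityʳ Λs)) (complete-literals Λs-lit)
  literally-complete (Γ ∷ G) = LiterallyComplete-∷ (reducible Γ) (literally-complete G)

  complete-CAN-free : ∀ G → Complete G
  complete-CAN-free G = literally-complete G []

theorem3p13 : (ℝ : Reals) → let open HR ℝ in
    (G : Hypersequent) → HRDerivable G → CANfreeDerivable G
theorem3p13 ℝ G d = Completeness.complete-CAN-free ℝ G (Semantics.sound ℝ d)
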